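{- For every $n\in\mathbb N=\{1,2,3,\dots\}$ there is a counterexample $G$ of order $5+12n$ to the following conjecture: if $G$ is an essentially $6$-edge-connected $4$-regular graph with a transition system $T$, then $(G,T)$ has no compatible cycle decomposition if and only if $(G,T)$ is the bad loop or the bad $K_5$.
   Context: A transition at a vertex $v$ is a pair of edges (half-edges, if there are loops) incident with $v$; a transition system $T$ of a $4$-regular graph $G$ consists, for each vertex $v$, of a partition of the four edges (half-edges) at $v$ into two transitions. A compatible cycle decomposition of $(G,T)$ is a decomposition of $E(G)$ into circuits (connected $2$-regular subgraphs) such that no circuit contains both members of a transition of $T$. A connected graph is essentially $k$-edge-connected if there is no edge cut with fewer than $k$ edges whose deletion leaves at least two components each containing an edge. The bad loop is a graph with a single vertex (with two loops), with the transition system whose transitions are the pairs of half-edges of the same loop. The bad $K_5$ is the complete graph $K_5$ with the transition system whose transitions are the pairs of adjacent edges that are consecutive on one of two fixed edge-disjoint hamiltonian circuits of $K_5$. -}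

module Defs where

open import Data.Bool.Base using (Bool; true; false; not; _xor_)
open import Data.Bool.Properties using (not-involutive)
open import Data.Fin.Base using (Fin)
open import Data.Fin.Patterns
open import Data.Fin.Properties using (_≟_; all?)
open import Data.Fin.Subset using (Subset; _∈_; ⊤; ∁; ∣_∣; Nonempty)
open import Data.Fin.Subset.Properties using (_∈?_; ∈⊤)
open import Data.List.Base using (List; []; _∷_; length; filter; allFin; cartesianProduct)
open import Data.Nat.Base using (ℕ; _<_)
open import Data.Product using (Σ; ∃!; ∃-syntax; _×_; _,_; proj₁; proj₂)
open import Data.Vec.Base using (Vec; []; _∷_; lookup; tabulate)
open import Function.Bundles using (_↔_; Inverse)
open import Relation.Binary.Construct.Closure.ReflexiveTransitive using (Star)
open import Relation.Binary.PropositionalEquality using (_≡_; _≢_; refl; cong)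
open import Relation.Nullary using (¬_; _×-dec_)
open import Relation.Nullary.Decidable using (from-yes)

-- Finite undirected graphs; loops and parallel edges are allowed.  The edge e
-- consists of the half-edges (e , false) and (e , true); the order in which an
-- edge lists its ends carries no meaning.
record Graph : Set where
  field
    order : ℕ
    size  : ℕ

    end   : Fin size × Bool → Fin order

  Vertex Edge HalfEdge : Set
  Vertex   = Fin order
  Edge     = Fin size
  HalfEdge = Edge × Bool

  edge : HalfEdge → Edge
  edge = proj₁

  opposite : HalfEdge → HalfEdge
  opposite (e , b) = e , not b

  halfEdges : List HalfEdge
  halfEdges = cartesianProduct (allFin size) (false ∷ true ∷ [])

open Graph

record Subgraph (G : Graph) : Set where
  field
    vertices : Subset (order G)
    edges    : Subset (size G)
    closed   : ∀ h → edge G h ∈ edges → end G h ∈ vertices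

open Subgraph

whole : (G : Graph) → Subgraph G
whole G = record { vertices = ⊤ ; edges = ⊤ ; closed = λ _ _ → ∈⊤ }

_∖_ : (G : Graph) → Subset (size G) → Subgraph G
G ∖ F = record { vertices = ⊤ ; edges = ∁ F ; closed = λ _ _ → ∈⊤ }

module _ {G : Graph} (H : Subgraph G) where

  -- Half-edges are counted, so a loop contributes 2.
  degree : Vertex G → ℕ
  degree v = length (filter (λ h → (edge G h ∈? edges H) ×-dec (end G h ≟ v)) (halfEdges G))

  Regular : ℕ → Set
  Regular k = ∀ v → v ∈ vertices H → degree v ≡ k

  Adjacent : Vertex G → Vertex G → Set
  Adjacent u v = ∃[ h ] edge G h ∈ edges H × end G h ≡ u × end G (opposite G h) ≡ v

  Reachable : Vertex G → Vertex G → Set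
  Reachable = Star Adjacent

  Connected : Set
  Connected = Nonempty (vertices H) ×
    (∀ u v → u ∈ vertices H → v ∈ vertices H → Reachable u v)

  IsCircuit : Set
  IsCircuit = Connected × Regular 2

  -- The component of u (its class under Reachable) contains an edge.
  ComponentHasEdge : Vertex G → Set
  ComponentHasEdge u = ∃[ h ] edge G h ∈ edges H × Reachable u (end G h)

  TwoComponentsWithEdges : Set
  TwoComponentsWithEdges = ∃[ u ] ∃[ v ] u ∈ vertices H × v ∈ vertices H ×
    ¬ Reachable u v × ComponentHasEdge u × ComponentHasEdge v

module _ (G : Graph) where

  -- The edges with exactly one end in X.
  δ : Subset (order G) → Subset (size G)
  δ X = tabulate λ e → lookup X (end G (e , false)) xor lookup X (end G (e , true))

  IsEdgeCut : Subset (size G) → Set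
  IsEdgeCut F = ∃[ X ] F ≡ δ X

  EssentiallyEdgeConnected : ℕ → Set
  EssentiallyEdgeConnected k = Connected (whole G) ×
    ¬ (∃[ F ] IsEdgeCut F × ∣ F ∣ < k × TwoComponentsWithEdges (G ∖ F))

-- A partition of the half-edges at each vertex into pairs, given by the map
-- sending a half-edge to the other member of its pair.  In a 4-regular graph
-- this makes exactly two transitions {h , partner h} at each vertex.
record TransitionSystem (G : Graph) : Set where
  field
    partner            : HalfEdge G → HalfEdge G
    partner-end        : ∀ h → end G (partner h) ≡ end G h
    partner-involutive : ∀ h → partner (partner h) ≡ h
    partner-distinct   : ∀ h → partner h ≢ h

open TransitionSystem

record CompatibleCycleDecomposition (G : Graph) (T : TransitionSystem G) : Set where
  field
    count      : ℕ
    circuit    : Fin count → Subgraph G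
    isCircuit  : ∀ i → IsCircuit (circuit i)
    decomposes : ∀ e → ∃! _≡_ λ i → e ∈ edges (circuit i)
    compatible : ∀ i h →
      ¬ (edge G h ∈ edges (circuit i) × edge G (partner T h) ∈ edges (circuit i))

infix 4 _≅_

-- Isomorphism of graphs with transition systems.
record _≅_ (A B : Σ Graph TransitionSystem) : Set where
  private
    G  = proj₁ A
    G′ = proj₁ B
  field
    vertex↔   : Vertex G ↔ Vertex G′
    halfEdge↔ : HalfEdge G ↔ HalfEdge G′
  private
    f = Inverse.to vertex↔
    g = Inverse.to halfEdge↔
  field
    end-preserved      : ∀ h → end G′ (g h) ≡ f (end G h)
    opposite-preserved : ∀ h → g (opposite G h) ≡ opposite G′ (g h)
    partner-preserved  : ∀ h → g (partner (proj₂ A) h) ≡ partner (proj₂ B) (g h)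

badLoop : Σ Graph TransitionSystem
badLoop = G , record
  { partner            = opposite G
  ; partner-end        = λ _ → refl
  ; partner-involutive = λ { (e , b) → cong (e ,_) (not-involutive b) }
  ; partner-distinct   = λ { (_ , false) () ; (_ , true) () }
  }
  where
  G : Graph
  G = record { order = 1 ; size = 2 ; end = λ _ → 0F }

-- Edges 0–4 are the hamiltonian circuit 0 1 2 3 4 of K₅, edges 5–9 the
-- circuit 0 2 4 1 3; each circuit is listed in cyclic order, every edge
-- directed from its false to its true half.
badK₅ : Σ Graph TransitionSystem
badK₅ = G , record
  { partner            = partner′
  ; partner-end        = λ
      { (e , false) → from-yes (all? λ e → end G (partner′ (e , false)) ≟ end G (e , false)) e
      ; (e , true)  → from-yes (all? λ e → end G (partner′ (e , true))  ≟ end G (e , true)) e }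
  ; partner-involutive = λ
      { (e , false) → cong (_, false) (from-yes (all? λ e → lookup next (lookup prev e) ≟ e) e)
      ; (e , true)  → cong (_, true)  (from-yes (all? λ e → lookup prev (lookup next e) ≟ e) e) }
  ; partner-distinct   = λ { (_ , false) () ; (_ , true) () }
  }
  where
  tail head : Vec (Fin 5) 10
  tail = 0F ∷ 1F ∷ 2F ∷ 3F ∷ 4F ∷ 0F ∷ 2F ∷ 4F ∷ 1F ∷ 3F ∷ []
  head = 1F ∷ 2F ∷ 3F ∷ 4F ∷ 0F ∷ 2F ∷ 4F ∷ 1F ∷ 3F ∷ 0F ∷ []

  next prev : Vec (Fin 10) 10
  next = 1F ∷ 2F ∷ 3F ∷ 4F ∷ 0F ∷ 6F ∷ 7F ∷ 8F ∷ 9F ∷ 5F ∷ []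
  prev = 4F ∷ 0F ∷ 1F ∷ 2F ∷ 3F ∷ 9F ∷ 5F ∷ 6F ∷ 7F ∷ 8F ∷ []

  G : Graph
  G = record
    { order = 5
    ; size  = 10
    ; end   = λ { (e , false) → lookup tail e ; (e , true) → lookup head e }
    }

  partner′ : HalfEdge G → HalfEdge G
  partner′ (e , false) = lookup prev e , true
  partner′ (e , true)  = lookup next e , false

{-# OPTIONS --safe #-}
module Submission where

-- Splitting every vertex of a 4-regular graph G along its two transitions gives
-- a cubic graph with a 2-factor F (the edges of G) and a perfect matching (the
-- vertices of G).  Colouring each edge by its circuit, a compatible cycle
-- decomposition is a colouring c of F such that at each vertex, with
-- transitions {a , b} and {a′ , b′}, c a ≠ c b and {c a , c b} = {c a′ , c b′}.
-- The bad K₅ gives the Petersen graph, which has no such colouring, and hence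
-- deleting an edge of F from it leaves a piece with few colourings at its four
-- ends.  An edge of F can be replaced by three of these pieces
-- and one matching edge, which adds 12 vertices to G, in such a way that
--   * every colouring of the new graph restricts to a colouring of the old one,
--   * every set of vertices cut off by fewer than six edges in the new graph
--     meets the old one in a set with the same property.
-- Both are finite checks on the replaced part, independent of the rest of the
-- graph, so iterating from K₅ keeps the graph uncolourable and essentially
-- 6-edge-connected.

open import Data.Bool.Base using (Bool; true; false; _xor_; _∧_; _∨_; T; if_then_else_)
open import Data.Bool.ListAction using (any)
import Data.Bool.Properties as Bool
open import Data.Bool.Properties using (T-∧; T-∨; T-≡; xor-same)
open import Data.Fin.Base using (Fin; zero; suc; toℕ; inject₁; _↑ˡ_; _↑ʳ_; splitAt)
open import Data.Fin.Patterns
open import Data.Fin.Permutation using (↔⇒≡)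
open import Data.Fin.Properties
  using (_≟_; all?; any?; sequence; splitAt⁻¹-↑ˡ; splitAt⁻¹-↑ʳ; ↑ˡ-injective; ↑ʳ-injective)
open import Data.Fin.Subset using (_∈_; _⊆_; ∣_∣)
open import Data.Fin.Subset.Properties using (_∈?_; ∈⊤; p⊆q⇒∣p∣≤∣q∣; x∉p⇒x∈∁p)
open import Data.List.Base
  using (List; []; _∷_; [_]; _++_; map; concatMap; length)
open import Data.List.Membership.Propositional using () renaming (_∈_ to _∈ˡ_)
open import Data.List.Membership.Propositional.Properties
  using (∈-∃++; ∈-filter⁺; ∈-filter⁻; ∈-allFin; ∈-cartesianProduct⁺; ∈-++⁻; ∈-++⁺ˡ; ∈-++⁺ʳ)
open import Data.List.Properties using (length-++)
open import Data.List.Relation.Unary.All as All using (All; []; _∷_)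
import Data.List.Relation.Unary.All.Properties as All
open import Data.List.Relation.Unary.AllPairs using ([]; _∷_)
open import Data.List.Relation.Unary.Any using (here; there)
import Data.List.Relation.Unary.Any.Properties as Any
open import Data.List.Relation.Unary.Unique.Propositional using (Unique)
import Data.List.Relation.Unary.Unique.Propositional.Properties as Unique
open import Data.Maybe.Base using (Maybe; just; nothing)
open import Data.Nat.Base
  using (ℕ; zero; suc; _+_; _*_; _≤_; _<_; z≤n; s≤s; _≤ᵇ_; _≡ᵇ_)
import Data.Nat.Properties as ℕ
open import Data.Nat.Properties
  using (+-assoc; +-suc; +-identityʳ; +-mono-≤; +-monoʳ-≤; +-monoˡ-≤; +-cancelʳ-≤; +-cancelˡ-≤;
         *-suc; ≤-trans; ≤-reflexive; ≤-antisym; m≤m+n; m≤n+m; 1+n≰n; <⇒≱; _≤?_; ≤ᵇ⇒≤; ≡ᵇ⇒≡;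
         module ≤-Reasoning)
open import Data.Nat.Solver using (module +-*-Solver)
open import Data.Product.Base as Product
  using (Σ; ∃; ∃-syntax; _×_; _,_; proj₁; proj₂; map₁)
open import Data.Sum.Base using (_⊎_; inj₁; inj₂; [_,_]′)
open import Data.Unit.Base using (tt)
open import Data.Vec.Base as Vec
  using (Vec; []; _∷_; lookup; replicate; tabulate; _[_]≔_)
open import Data.Vec.Properties
  using (lookup∘update; lookup∘update′; lookup∘tabulate; lookup-replicate; []=⇒lookup;
         map-∘; map-cong)
open import Data.Vec.Relation.Unary.All as VecAll using ([]; _∷_)
import Data.Vec.Relation.Unary.All.Properties as VecAll
open import Effect.Monad using (RawMonad)
open import Function.Base using (_∘_; id)
open import Function.Bundles using (_⇔_; Equivalence)
open import Relation.Binary.Construct.Closure.Equivalence using (EqClosure; symmetric)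
open import Relation.Binary.Construct.Closure.ReflexiveTransitive
  using (ε; _◅_; _◅◅_; gmap; kleisliStar; reverse)
open import Relation.Binary.Construct.Closure.Symmetric using (fwd; bwd)
open import Relation.Binary.PropositionalEquality
  using (_≡_; _≢_; refl; sym; trans; cong; cong₂; subst; module ≡-Reasoning)
open import Relation.Nullary using (¬_; Dec; yes; no; does; contradiction)
open import Relation.Nullary.Decidable
  using (_×-dec_; _⊎-dec_; _→-dec_; ¬?; map′; ⌊_⌋; toWitness; dec-true; ¬¬-excluded-middle)
open import Relation.Nullary.Negation using (¬¬-Monad)
open import Defs

-- Networks and their extension by three Petersen pieces

-- The two strands (v , false) and (v , true) are the ends in the cubic graph of
-- the matching edge v.  A network orients F: the edge named h runs from the
-- vertex of h to that of next h, and its transition at the former is with the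
-- edge named prev h.
Strand : ℕ → Set
Strand N = Fin N × Bool

-- The middle edge of the path 0 → 1 → 2 → 3 is the one replaced by an extension.
record Network (m : ℕ) : Set where
  field
    next prev : Strand (4 + m) → Strand (4 + m)
    prev-next : ∀ h → prev (next h) ≡ h
    next-prev : ∀ h → next (prev h) ≡ h
    loopless  : ∀ h → proj₁ (next h) ≢ proj₁ h
    spine     : ∀ (i : Fin 3) → next (inject₁ i ↑ˡ m , false) ≡ (suc i ↑ˡ m , false)

  spine⁻¹ : ∀ (i : Fin 3) → prev (suc i ↑ˡ m , false) ≡ (inject₁ i ↑ˡ m , false)
  spine⁻¹ i = trans (cong prev (sym (spine i))) (prev-next _)

pattern 10F = suc 9F
pattern 11F = suc 10F

pattern old v =
  suc (suc (suc (suc (suc (suc (suc (suc (suc (suc (suc (suc v)))))))))))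

pattern inner w = suc (suc (suc (suc w)))

lift : ∀ {N} → Strand N → Strand (12 + N)
lift = map₁ (λ v → old v)

-- Three copies of the Petersen graph minus an edge, with outer paths
-- (0 , 1 , 2), (4 , 5 , 6), (7 , 8 , 9) of false strands, and the matching edge 3.
-- The old strands (1 , false) and (2 , false) move to the inner circuits of the
-- last two copies.  The next spine is the new path 0 → 1 → 2 → 3.
module _ {m : ℕ} (next prev : Strand (4 + m) → Strand (4 + m)) where

  extNext extPrev : Strand (12 + (4 + m)) → Strand (12 + (4 + m))
  extNext (0F , false) = 1F , false
  extNext (0F , true)  = 2F , true
  extNext (1F , false) = 2F , false
  extNext (1F , true)  = 10F , false
  extNext (2F , false) = 3F , false
  extNext (2F , true)  = 11F , false
  extNext (3F , false) = old 3F , false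
  extNext (3F , true)  = 4F , false
  extNext (4F , false) = 5F , false
  extNext (4F , true)  = 6F , true
  extNext (5F , false) = 6F , false
  extNext (5F , true)  = 10F , true
  extNext (6F , false) = 9F , false
  extNext (6F , true)  = old 1F , false
  extNext (7F , false) = 3F , true
  extNext (7F , true)  = 9F , true
  extNext (8F , false) = 7F , false
  extNext (8F , true)  = old 2F , false
  extNext (9F , false) = 8F , false
  extNext (9F , true)  = 11F , true
  extNext (10F , false) = 0F , true
  extNext (10F , true)  = 4F , true
  extNext (11F , false) = 1F , true
  extNext (11F , true)  = 8F , true
  extNext (old 0F , false) = 0F , false
  extNext (old 0F , true)  = lift (next (0F , true))
  extNext (old 1F , false) = 5F , true
  extNext (old 1F , true)  = lift (next (1F , true))
  extNext (old 2F , false) = 7F , true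
  extNext (old 2F , true)  = lift (next (2F , true))
  extNext (old 3F , s) = lift (next (3F , s))
  extNext (old (inner w) , s) = lift (next (inner w , s))

  extPrev (0F , false) = old 0F , false
  extPrev (0F , true)  = 10F , false
  extPrev (1F , false) = 0F , false
  extPrev (1F , true)  = 11F , false
  extPrev (2F , false) = 1F , false
  extPrev (2F , true)  = 0F , true
  extPrev (3F , false) = 2F , false
  extPrev (3F , true)  = 7F , false
  extPrev (4F , false) = 3F , true
  extPrev (4F , true)  = 10F , true
  extPrev (5F , false) = 4F , false
  extPrev (5F , true)  = old 1F , false
  extPrev (6F , false) = 5F , false
  extPrev (6F , true)  = 4F , true
  extPrev (7F , false) = 8F , false
  extPrev (7F , true)  = old 2F , false
  extPrev (8F , false) = 9F , false
  extPrev (8F , true)  = 11F , true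
  extPrev (9F , false) = 6F , false
  extPrev (9F , true)  = 7F , true
  extPrev (10F , false) = 1F , true
  extPrev (10F , true)  = 5F , true
  extPrev (11F , false) = 2F , true
  extPrev (11F , true)  = 9F , true
  extPrev (old 0F , s) = lift (prev (0F , s))
  extPrev (old 1F , false) = 6F , true
  extPrev (old 1F , true)  = lift (prev (1F , true))
  extPrev (old 2F , false) = 8F , true
  extPrev (old 2F , true)  = lift (prev (2F , true))
  extPrev (old 3F , false) = 3F , false
  extPrev (old 3F , true)  = lift (prev (3F , true))
  extPrev (old (inner w) , s) = lift (prev (inner w , s))

module Extension {m : ℕ} (B : Network m) where
  open Network B

  next′ prev′ : Strand (12 + (4 + m)) → Strand (12 + (4 + m))
  next′ = extNext next prev
  prev′ = extPrev next prev

  -- Excludes the strands `(1 , false)`, `(2 , false)`, `(3 , false)`: these follow the three spine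
  -- edges and are the only old strands whose predecessor changes in the extension.
  OffSpine : Strand (4 + m) → Set
  OffSpine h = ∀ (i : Fin 3) → h ≢ (suc i ↑ˡ m , false)

  next-lift : ∀ h → OffSpine (next h) → next′ (lift h) ≡ lift (next h)
  next-lift (0F , false) off = contradiction (spine 0F) (off 0F)
  next-lift (0F , true)  off = refl
  next-lift (1F , false) off = contradiction (spine 1F) (off 1F)
  next-lift (1F , true)  off = refl
  next-lift (2F , false) off = contradiction (spine 2F) (off 2F)
  next-lift (2F , true)  off = refl
  next-lift (3F , s) off = refl
  next-lift (inner w , s) off = refl

  prev-lift : ∀ h → OffSpine h → prev′ (lift h) ≡ lift (prev h)
  prev-lift (0F , s) off = refl
  prev-lift (1F , false) off = contradiction refl (off 0F)
  prev-lift (1F , true)  off = refl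
  prev-lift (2F , false) off = contradiction refl (off 1F)
  prev-lift (2F , true)  off = refl
  prev-lift (3F , false) off = contradiction refl (off 2F)
  prev-lift (3F , true)  off = refl
  prev-lift (inner w , s) off = refl

  -- The spine edges are exactly the predecessors of the excluded strands, and `prev` undoes `next`.
  next-off : ∀ h → (∀ (i : Fin 3) → h ≢ (inject₁ i ↑ˡ m , false)) → OffSpine (next h)
  next-off h off i eq = off i (trans (sym (prev-next h)) (trans (cong prev eq) (spine⁻¹ i)))

  prev-next-lift : ∀ h → (∀ (i : Fin 3) → h ≢ (inject₁ i ↑ˡ m , false)) →
                   prev′ (lift (next h)) ≡ lift h
  prev-next-lift h off =
    trans (prev-lift (next h) (next-off h off)) (cong lift (prev-next h))

  next-prev-lift : ∀ h → OffSpine h → next′ (lift (prev h)) ≡ lift h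
  next-prev-lift h off =
    trans (next-lift (prev h) (λ i eq → off i (trans (sym (next-prev h)) eq)))
          (cong lift (next-prev h))

  prev-next′ : ∀ h → prev′ (next′ h) ≡ h
  prev-next′ (0F , false) = refl
  prev-next′ (0F , true)  = refl
  prev-next′ (1F , false) = refl
  prev-next′ (1F , true)  = refl
  prev-next′ (2F , false) = refl
  prev-next′ (2F , true)  = refl
  prev-next′ (3F , false) = refl
  prev-next′ (3F , true)  = refl
  prev-next′ (4F , false) = refl
  prev-next′ (4F , true)  = refl
  prev-next′ (5F , false) = refl
  prev-next′ (5F , true)  = refl
  prev-next′ (6F , false) = refl
  prev-next′ (6F , true)  = refl
  prev-next′ (7F , false) = refl
  prev-next′ (7F , true)  = refl
  prev-next′ (8F , false) = refl
  prev-next′ (8F , true)  = refl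
  prev-next′ (9F , false) = refl
  prev-next′ (9F , true)  = refl
  prev-next′ (10F , false) = refl
  prev-next′ (10F , true)  = refl
  prev-next′ (11F , false) = refl
  prev-next′ (11F , true)  = refl
  prev-next′ (old 0F , false) = refl
  prev-next′ (old 0F , true)  = prev-next-lift _ λ { 0F () ; 1F () ; 2F () }
  prev-next′ (old 1F , false) = refl
  prev-next′ (old 1F , true)  = prev-next-lift _ λ { 0F () ; 1F () ; 2F () }
  prev-next′ (old 2F , false) = refl
  prev-next′ (old 2F , true)  = prev-next-lift _ λ { 0F () ; 1F () ; 2F () }
  prev-next′ (old 3F , s) = prev-next-lift _ λ { 0F () ; 1F () ; 2F () }
  prev-next′ (old (inner w) , s) = prev-next-lift _ λ { 0F () ; 1F () ; 2F () }

  next-prev′ : ∀ h → next′ (prev′ h) ≡ h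
  next-prev′ (0F , false) = refl
  next-prev′ (0F , true)  = refl
  next-prev′ (1F , false) = refl
  next-prev′ (1F , true)  = refl
  next-prev′ (2F , false) = refl
  next-prev′ (2F , true)  = refl
  next-prev′ (3F , false) = refl
  next-prev′ (3F , true)  = refl
  next-prev′ (4F , false) = refl
  next-prev′ (4F , true)  = refl
  next-prev′ (5F , false) = refl
  next-prev′ (5F , true)  = refl
  next-prev′ (6F , false) = refl
  next-prev′ (6F , true)  = refl
  next-prev′ (7F , false) = refl
  next-prev′ (7F , true)  = refl
  next-prev′ (8F , false) = refl
  next-prev′ (8F , true)  = refl
  next-prev′ (9F , false) = refl
  next-prev′ (9F , true)  = refl
  next-prev′ (10F , false) = refl
  next-prev′ (10F , true)  = refl
  next-prev′ (11F , false) = refl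
  next-prev′ (11F , true)  = refl
  next-prev′ (old 0F , s) = next-prev-lift _ λ { 0F () ; 1F () ; 2F () }
  next-prev′ (old 1F , false) = refl
  next-prev′ (old 1F , true)  = next-prev-lift _ λ { 0F () ; 1F () ; 2F () }
  next-prev′ (old 2F , false) = refl
  next-prev′ (old 2F , true)  = next-prev-lift _ λ { 0F () ; 1F () ; 2F () }
  next-prev′ (old 3F , false) = refl
  next-prev′ (old 3F , true)  = next-prev-lift _ λ { 0F () ; 1F () ; 2F () }
  next-prev′ (old (inner w) , s) = next-prev-lift _ λ { 0F () ; 1F () ; 2F () }

  loopless-lift : ∀ h → proj₁ (lift (next h)) ≢ proj₁ (lift h)
  loopless-lift h eq = loopless h (↑ʳ-injective 12 _ _ eq)

  loopless′ : ∀ h → proj₁ (next′ h) ≢ proj₁ h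
  loopless′ (0F , false) ()
  loopless′ (0F , true)  ()
  loopless′ (1F , false) ()
  loopless′ (1F , true)  ()
  loopless′ (2F , false) ()
  loopless′ (2F , true)  ()
  loopless′ (3F , false) ()
  loopless′ (3F , true)  ()
  loopless′ (4F , false) ()
  loopless′ (4F , true)  ()
  loopless′ (5F , false) ()
  loopless′ (5F , true)  ()
  loopless′ (6F , false) ()
  loopless′ (6F , true)  ()
  loopless′ (7F , false) ()
  loopless′ (7F , true)  ()
  loopless′ (8F , false) ()
  loopless′ (8F , true)  ()
  loopless′ (9F , false) ()
  loopless′ (9F , true)  ()
  loopless′ (10F , false) ()
  loopless′ (10F , true)  ()
  loopless′ (11F , false) ()
  loopless′ (11F , true)  ()
  loopless′ (old 0F , false) ()
  loopless′ (old 0F , true)  = loopless-lift (0F , true)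
  loopless′ (old 1F , false) ()
  loopless′ (old 1F , true)  = loopless-lift (1F , true)
  loopless′ (old 2F , false) ()
  loopless′ (old 2F , true)  = loopless-lift (2F , true)
  loopless′ (old 3F , s) = loopless-lift (3F , s)
  loopless′ (old (inner w) , s) = loopless-lift (inner w , s)

  extension : Network (12 + m)
  extension = record
    { next = next′ ; prev = prev′ ; prev-next = prev-next′ ; next-prev = next-prev′
    ; loopless = loopless′ ; spine = λ { 0F → refl ; 1F → refl ; 2F → refl } }

-- Counting cut edges and exhaustive search over vertex sets

bit : Bool → ℕ
bit false = 0
bit true  = 1

bit≤1 : ∀ b → bit b ≤ 1
bit≤1 false = z≤n
bit≤1 true  = s≤s z≤n

total : ∀ N → (Strand N → Bool) → ℕ
total zero    g = 0
total (suc N) g = bit (g (zero , false)) + (bit (g (zero , true)) + total N (g ∘ map₁ suc))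

total-+ : ∀ k {N} (g : Strand (k + N) → Bool) →
          total (k + N) g ≡ total k (g ∘ map₁ (_↑ˡ N)) + total N (g ∘ map₁ (k ↑ʳ_))
total-+ zero    g = refl
total-+ (suc k) g = begin
  x + (y + total (k + _) g′)  ≡⟨ cong (λ t → x + (y + t)) (total-+ k g′) ⟩
  x + (y + (p + q))           ≡⟨ cong (x +_) (sym (+-assoc y p q)) ⟩
  x + (y + p + q)             ≡⟨ sym (+-assoc x (y + p) q) ⟩
  x + (y + p) + q             ∎
  where
  open ≡-Reasoning
  x = bit (g (zero , false))
  y = bit (g (zero , true))
  g′ = g ∘ map₁ suc
  p = total k (g′ ∘ map₁ (_↑ˡ _))
  q = total _ (g′ ∘ map₁ (k ↑ʳ_))

crosses : ∀ {N} → (Strand N → Strand N) → (Fin N → Bool) → Strand N → Bool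
crosses next X h = X (proj₁ h) xor X (proj₁ (next h))

cut : ∀ {N} → (Strand N → Strand N) → (Fin N → Bool) → ℕ
cut next X = total _ (crosses next X)

-- Search through the vertex sets, abandoning a branch once six edges are cut.
module Search {k : ℕ} where

  Env : Set
  Env = Vec (Maybe Bool) k

  record Agrees (env : Env) (X : Fin k → Bool) : Set where
    constructor agrees
    field agree : ∀ i b → lookup env i ≡ just b → X i ≡ b
  open Agrees

  links : List (Fin k × Fin k) → (Fin k → Bool) → ℕ
  links []             X = 0
  links ((i , j) ∷ ls) X = bit (X i xor X j) + links ls X

  links-++ : ∀ ls ms X → links (ls ++ ms) X ≡ links ls X + links ms X
  links-++ []             ms X = refl
  links-++ ((i , j) ∷ ls) ms X =
    trans (cong (bit (X i xor X j) +_) (links-++ ls ms X)) (sym (+-assoc (bit (X i xor X j)) _ _))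

  branch : Fin k → Env → Maybe Bool → (Bool → Env → Bool) → Bool
  branch i env (just b) f = f b env
  branch i env nothing  f = f false (env [ i ]≔ just false) ∧ f true (env [ i ]≔ just true)

  assign : Fin k → Env → (Bool → Env → Bool) → Bool
  assign i env f = branch i env (lookup env i) f

  update-agrees : ∀ {env X} i b → Agrees env X → X i ≡ b → Agrees (env [ i ]≔ just b) X
  update-agrees {env} {X} i b ag Xi = agrees agree′
    where
    agree′ : ∀ j c → lookup (env [ i ]≔ just b) j ≡ just c → X j ≡ c
    agree′ j c eq with j ≟ i
    ... | yes refl with refl ← trans (sym (lookup∘update i env (just b))) eq = Xi
    ... | no j≢i   = agree ag j c (trans (sym (lookup∘update′ j≢i env (just b))) eq)

  -- The test passes in every branch, in particular in the one that gives `i` its value under `X`.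
  branch-sound : ∀ {env X} i r (f : Bool → Env → Bool) → lookup env i ≡ r → Agrees env X →
                 T (branch i env r f) → ∃[ env′ ] Agrees env′ X × T (f (X i) env′)
  branch-sound {env} i (just b) f eq ag t =
    env , ag , subst (λ c → T (f c env)) (sym (agree ag i b eq)) t
  branch-sound {env} {X} i nothing f eq ag t
    with Equivalence.to (T-∧ {f false (env [ i ]≔ just false)}) t | X i in Xi
  ... | t₀ , t₁ | false = _ , update-agrees i false ag Xi , t₀
  ... | t₀ , t₁ | true  = _ , update-agrees i true  ag Xi , t₁

  assign-sound : ∀ {env X} i (f : Bool → Env → Bool) → Agrees env X → T (assign i env f) →
                 ∃[ env′ ] Agrees env′ X × T (f (X i) env′)
  assign-sound {env} i f ag t = branch-sound i (lookup env i) f refl ag t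

  assignRest : ∀ {l} → (Fin (suc l) → Fin k) → (Vec Bool (suc l) → Bool) → Bool → Env → Bool
  assignAll : ∀ {l} → (Fin l → Fin k) → Env → (Vec Bool l → Bool) → Bool
  assignAll {zero}  ix env f = f []
  assignAll {suc l} ix env f =
    assign (ix zero) env (assignRest ix f)
  assignRest ix f b env = assignAll (ix ∘ suc) env λ bs → f (b ∷ bs)

  assignAll-sound : ∀ {l env X} (ix : Fin l → Fin k) (f : Vec Bool l → Bool) → Agrees env X →
                    T (assignAll ix env f) → T (f (tabulate (X ∘ ix)))
  assignAll-sound {zero}  ix f ag t = t
  assignAll-sound {suc l} {X = X} ix f ag t
    with _ , ag′ , t′ ← assign-sound (ix zero) (assignRest ix f) ag t =
    assignAll-sound (ix ∘ suc) (λ bs → f (X (ix zero) ∷ bs)) ag′ t′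

  module _ {P : (Fin k → Bool) → ℕ → Set} (P? : ∀ X c → Dec (P X c)) where

    scan  : List (Fin k × Fin k) → Env → ℕ → Bool
    scan₁ : Fin k → List (Fin k × Fin k) → ℕ → Bool → Env → Bool
    scan₂ : List (Fin k × Fin k) → ℕ → Bool → Bool → Env → Bool
    -- Reads the assignment off as a vector, branching on any vertex that no link has met.
    scan []             env c = assignAll (λ i → i) env λ bs → ⌊ P? (lookup bs) c ⌋
    scan ((i , j) ∷ ls) env c = assign i env (scan₁ j ls c)
    scan₁ j ls c a env   = assign j env (scan₂ ls c a)
    scan₂ ls c a b env   = (6 ≤ᵇ c + bit (a xor b)) ∨ scan ls env (c + bit (a xor b))

    scan-sound : ∀ {X} ls env c → Agrees env X → T (scan ls env c) →
                 6 ≤ c + links ls X ⊎ P (lookup (tabulate X)) (c + links ls X)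
    scan-sound {X} [] env c ag t rewrite +-identityʳ c =
      inj₂ (toWitness (assignAll-sound (λ i → i) (λ bs → ⌊ P? (lookup bs) c ⌋) ag t))
    scan-sound {X} ((i , j) ∷ ls) env c ag t
      with env₁ , ag₁ , t₁ ← assign-sound i (scan₁ j ls c) ag t
      with env₂ , ag₂ , t₂ ← assign-sound j (scan₂ ls c (X i)) ag₁ t₁
      rewrite sym (+-assoc c (bit (X i xor X j)) (links ls X))
      with Equivalence.to (T-∨ {6 ≤ᵇ c + bit (X i xor X j)}) t₂
    ... | inj₁ big  = inj₁ (≤-trans (≤ᵇ⇒≤ 6 (c + bit (X i xor X j)) big) (m≤m+n _ _))
    ... | inj₂ rest = scan-sound ls env₂ (c + bit (X i xor X j)) ag₂ rest

    -- The search enumerates vectors, so `P` is obtained for `lookup (tabulate X)`, which agrees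
    -- with `X` pointwise; users transfer it along that agreement.
    search : ∀ ls → T (scan ls (replicate k nothing) 0) →
             ∀ X → 6 ≤ links ls X ⊎ P (lookup (tabulate X)) (links ls X)
    search ls t X = scan-sound ls (replicate k nothing) 0 (agrees none) t
      where
      none : ∀ i b → lookup (replicate k nothing) i ≡ just b → X i ≡ b
      none i b eq with () ← trans (sym (lookup-replicate i nothing)) eq

∀Bool? : {P : Bool → Set} → (∀ b → Dec (P b)) → Dec (∀ b → P b)
∀Bool? P? = map′ (λ { (f , t) false → f ; (f , t) true → t }) (λ p → p false , p true)
                 (P? false ×-dec P? true)

∃Bool? : {P : Bool → Set} → (∀ b → Dec (P b)) → Dec (∃ P)
∃Bool? P? = map′ [ (λ p → false , p) , (λ p → true , p) ]′
                 (λ { (false , p) → inj₁ p ; (true , p) → inj₂ p })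
                 (P? false ⊎-dec P? true)

-- Small cuts: the check on the new part and the base case

Uniform AlmostUniform : ∀ {N} → (Fin N → Bool) → Set
Uniform       X = ∃[ b ] ∀ v → X v ≡ b
AlmostUniform X = ∃[ b ] ∃[ z ] ∀ v → v ≢ z → X v ≡ b

-- The edges of an extension that are not edges of the old network join the
-- vertices 0–15 only, of which 12–15 are the old 0–3.  They can therefore be read
-- off the extension of a network with four vertices, whose own edges are never
-- consulted.
module _ where
  open Search {16}

  links₀ links₁ linksNew : List (Fin 16 × Fin 16)
  link : Strand 16 → Fin 16 × Fin 16
  link h = proj₁ h , proj₁ (extNext {0} (λ h → h) (λ h → h) h)
  links₀ = concatMap (λ v → link (v , false) ∷ link (v , true) ∷ [])
    (0F ∷ 1F ∷ 2F ∷ 3F ∷ 4F ∷ 5F ∷ 6F ∷ 7F ∷ 8F ∷ 9F ∷ 10F ∷ 11F ∷ [])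
  links₁ = link (old 0F , false) ∷ link (old 1F , false) ∷ link (old 2F , false) ∷ []
  linksNew = links₀ ++ links₁

  spineCut : (Fin 4 → Bool) → ℕ
  spineCut t = bit (t 0F xor t 1F) + (bit (t 1F xor t 2F) + bit (t 2F xor t 3F))

  spineCut≤3 : ∀ t → spineCut t ≤ 3
  spineCut≤3 t = +-mono-≤ (bit≤1 (t 0F xor t 1F)) (+-mono-≤ (bit≤1 (t 1F xor t 2F)) (bit≤1 (t 2F xor t 3F)))

  -- What makes an extension keep small cuts trivial, for a cut given by x on the
  -- new vertices and t on the old vertices 0–3, with c of the new edges cut.
  record Local (x : Fin 12 → Bool) (t : Fin 4 → Bool) (c : ℕ) : Set where
    constructor local
    field
      spine≤   : spineCut t ≤ c
      uniform  : ∀ b → (∀ i → t i ≡ b) → 4 ≤ c ⊎ (∀ j → x j ≡ b)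
      uniform′ : ∀ b → (∀ i → t i ≡ b) → c ≤ 5 → ∃[ z ] ∀ j → j ≢ z → x j ≡ b
      almost   : ∀ b z → (∀ i → i ≢ z → t i ≡ b) → c ≤ 1 + spineCut t → ∀ j → x j ≡ b

  local? : ∀ x t c → Dec (Local x t c)
  local? x t c = map′ (λ { (p , q , r , s) → local p q r s })
                      (λ { (local p q r s) → p , q , r , s })
    (spineCut t ≤? c ×-dec
     ∀Bool? (λ b → all? (λ i → t i Bool.≟ b) →-dec (4 ≤? c ⊎-dec all? (λ j → x j Bool.≟ b))) ×-dec
     ∀Bool? (λ b → all? (λ i → t i Bool.≟ b) →-dec
                   (c ≤? 5 →-dec any? λ z → all? λ j → ¬? (j ≟ z) →-dec x j Bool.≟ b)) ×-dec
     ∀Bool? (λ b → all? λ z → all? (λ i → ¬? (i ≟ z) →-dec t i Bool.≟ b) →-dec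
                   (c ≤? 1 + spineCut t →-dec all? λ j → x j Bool.≟ b)))

  -- The proof is an evaluation: `tt` is accepted because `scan` on the new edges computes to
  -- `true`.
  newLocal : ∀ X → 6 ≤ links linksNew X ⊎
    Local (λ j → lookup (tabulate X) (j ↑ˡ 4)) (λ i → lookup (tabulate X) (12 ↑ʳ i)) (links linksNew X)
  newLocal = search (λ X c → local? (λ j → X (j ↑ˡ 4)) (λ i → X (12 ↑ʳ i)) c) linksNew tt

-- The second half says that fewer than six edges separate at most one vertex from the rest, which
-- yields essential 6-edge-connectedness. The first half is 4-edge-connectedness; it is carried
-- along because the induction needs the lower bound 4 on the old cut to limit the number of new
-- edges cut.
Tight : ∀ {N} → (Strand N → Strand N) → Set
Tight next = ∀ X → (4 ≤ cut next X ⊎ Uniform X) × (cut next X ≤ 5 → AlmostUniform X)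

-- The bad K₅, with its two hamiltonian circuits as the two kinds of strands.
petersenNext petersenPrev : Strand 5 → Strand 5
petersenNext (0F , false) = 1F , false
petersenNext (1F , false) = 2F , false
petersenNext (2F , false) = 3F , false
petersenNext (3F , false) = 4F , false
petersenNext (4F , false) = 0F , false
petersenNext (0F , true)  = 2F , true
petersenNext (1F , true)  = 3F , true
petersenNext (2F , true)  = 4F , true
petersenNext (3F , true)  = 0F , true
petersenNext (4F , true)  = 1F , true
petersenPrev (0F , false) = 4F , false
petersenPrev (1F , false) = 0F , false
petersenPrev (2F , false) = 1F , false
petersenPrev (3F , false) = 2F , false
petersenPrev (4F , false) = 3F , false
petersenPrev (0F , true)  = 3F , true
petersenPrev (1F , true)  = 4F , true
petersenPrev (2F , true)  = 0F , true
petersenPrev (3F , true)  = 1F , true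
petersenPrev (4F , true)  = 2F , true

petersen : Network 1
petersen = record
  { next = petersenNext
  ; prev = petersenPrev
  ; prev-next = λ
      { (0F , false) → refl ; (1F , false) → refl ; (2F , false) → refl ; (3F , false) → refl
      ; (4F , false) → refl ; (0F , true) → refl ; (1F , true) → refl ; (2F , true) → refl
      ; (3F , true) → refl ; (4F , true) → refl }
  ; next-prev = λ
      { (0F , false) → refl ; (1F , false) → refl ; (2F , false) → refl ; (3F , false) → refl
      ; (4F , false) → refl ; (0F , true) → refl ; (1F , true) → refl ; (2F , true) → refl
      ; (3F , true) → refl ; (4F , true) → refl }
  ; loopless = λ
      { (0F , false) () ; (1F , false) () ; (2F , false) () ; (3F , false) () ; (4F , false) ()
      ; (0F , true) () ; (1F , true) () ; (2F , true) () ; (3F , true) () ; (4F , true) () }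
  ; spine = λ { 0F → refl ; 1F → refl ; 2F → refl }
  }

module _ where
  open Search {5}

  petersenLinks : List (Fin 5 × Fin 5)
  petersenLinks = concatMap (λ v → ends (v , false) ∷ ends (v , true) ∷ []) (0F ∷ 1F ∷ 2F ∷ 3F ∷ 4F ∷ [])
    where
    ends : Strand 5 → Fin 5 × Fin 5
    ends h = proj₁ h , proj₁ (petersenNext h)

  Verdict : (Fin 5 → Bool) → ℕ → Set
  Verdict X c = (4 ≤ c ⊎ Uniform X) × (c ≤ 5 → AlmostUniform X)

  verdict? : ∀ X c → Dec (Verdict X c)
  verdict? X c =
    (4 ≤? c ⊎-dec ∃Bool? λ b → all? λ v → X v Bool.≟ b) ×-dec
    (c ≤? 5 →-dec ∃Bool? λ b → any? λ z → all? λ v → ¬? (v ≟ z) →-dec X v Bool.≟ b)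

  petersenSearch : ∀ X → 6 ≤ links petersenLinks X ⊎ Verdict (lookup (tabulate X)) (links petersenLinks X)
  petersenSearch = search verdict? petersenLinks tt

  petersenVerdict : ∀ X c → 6 ≤ c ⊎ Verdict (lookup (tabulate X)) c → Verdict X c
  petersenVerdict X c (inj₁ 6≤c) =
    inj₁ (≤-trans (m≤n+m 4 2) 6≤c) , λ c≤5 → contradiction (≤-trans 6≤c c≤5) 1+n≰n
  petersenVerdict X c (inj₂ (p , q)) =
    [ inj₁ , (λ (b , u) → inj₂ (b , λ v → trans (sym (lookup∘tabulate X v)) (u v))) ]′ p ,
    λ c≤5 → let b , z , a = q c≤5 in
      b , z , λ v v≢z → trans (sym (lookup∘tabulate X v)) (a v v≢z)

  petersen-tight : Tight petersenNext
  petersen-tight X = petersenVerdict X (links petersenLinks X) (petersenSearch X)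

-- Small cuts in an extension

local-resp : ∀ {x x′ t t′ c} → (∀ j → x j ≡ x′ j) → (∀ i → t i ≡ t′ i) →
             Local x t c → Local x′ t′ c
local-resp {t = t} {t′} {c} x≗ t≗ (local p q r s) = local
  (subst (_≤ c) spine≡ p)
  (λ b u → [ inj₁ , (λ f → inj₂ λ j → trans (sym (x≗ j)) (f j)) ]′ (q b λ i → trans (t≗ i) (u i)))
  (λ b u c≤5 → let z , f = r b (λ i → trans (t≗ i) (u i)) c≤5 in
    z , λ j j≢z → trans (sym (x≗ j)) (f j j≢z))
  (λ b z u c≤ j → trans (sym (x≗ j))
    (s b z (λ i i≢z → trans (t≗ i) (u i i≢z)) (subst (λ k → c ≤ 1 + k) (sym spine≡) c≤) j))
  where
  spine≡ : spineCut t ≡ spineCut t′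
  spine≡ rewrite t≗ 0F | t≗ 1F | t≗ 2F | t≗ 3F = refl

module _ {m : ℕ} (B : Network m) where
  open Network B
  open Extension B

  data Place : Fin (12 + (4 + m)) → Set where
    new : ∀ (j : Fin 12) → Place (j ↑ˡ (4 + m))
    kept : ∀ v → Place (12 ↑ʳ v)

  place : ∀ v → Place v
  place v with splitAt 12 v in eq
  ... | inj₁ j = subst Place (splitAt⁻¹-↑ˡ eq) (new j)
  ... | inj₂ w = subst Place (splitAt⁻¹-↑ʳ eq) (kept w)

  module _ (X : Fin (12 + (4 + m)) → Bool) where
    open Search {16} using (links; links-++)

    private
      X₁₆ : Fin 16 → Bool
      X₁₆ = X ∘ (_↑ˡ m)

      X₀ : Fin (4 + m) → Bool
      X₀ = X ∘ (12 ↑ʳ_)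

      x : Fin 12 → Bool
      x j = X (j ↑ˡ (4 + m))

      t : Fin 4 → Bool
      t i = X₀ (i ↑ˡ m)

      c : ℕ
      c = links linksNew X₁₆

    -- The extension loses the three spine edges of the old network, gains the edges in `linksNew`,
    -- and keeps all others. The lost edges are put on the left to avoid subtraction.
    cut-extension : cut next′ X + spineCut t ≡ cut next X₀ + c
    cut-extension = begin
      cut next′ X + spineCut t
        ≡⟨ cong (_+ spineCut t) (total-+ 12 (crosses next′ X)) ⟩
      links links₀ X₁₆ + total (4 + m) (crosses next′ X ∘ map₁ (12 ↑ʳ_)) + spineCut t
        -- Here `a`, `b`, `d` are the new edges leaving the old vertices 0, 1, 2, and `x`, `y`, `z`
        -- the lost spine edges; `n` is the sum over the new vertices, which unfolds to
        -- `links links₀`, and `con 0` is the end of the list `links₁`.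
        ≡⟨ solve 10 (λ n a p b q d r x y z →
             n :+ (a :+ (p :+ (b :+ (q :+ (d :+ r))))) :+ (x :+ (y :+ z)) :=
             x :+ (p :+ (y :+ (q :+ (z :+ r)))) :+ (n :+ (a :+ (b :+ (d :+ con 0)))))
             refl (links links₀ X₁₆) a₀ p b₀ q d₀ r x₀ y₀ z₀ ⟩
      x₀ + (p + (y₀ + (q + (z₀ + r)))) + (links links₀ X₁₆ + links links₁ X₁₆)
        ≡⟨ cong₂ _+_ (cong₂ _+_ (spineBit 0F) (cong (p +_) (cong₂ _+_ (spineBit 1F)
             (cong (q +_) (cong (_+ r) (spineBit 2F))))))
             (sym (links-++ links₀ links₁ X₁₆)) ⟩
      cut next X₀ + c ∎
      where
      open ≡-Reasoning
      open +-*-Solver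
      a₀ = bit (X (old 0F) xor X 0F)
      b₀ = bit (X (old 1F) xor X 5F)
      d₀ = bit (X (old 2F) xor X 7F)
      x₀ = bit (t 0F xor t 1F)
      y₀ = bit (t 1F xor t 2F)
      z₀ = bit (t 2F xor t 3F)
      p = bit (crosses next X₀ (0F , true))
      q = bit (crosses next X₀ (1F , true))
      r = bit (crosses next X₀ (2F , true)) + (bit (crosses next X₀ (3F , false)) +
          (bit (crosses next X₀ (3F , true)) + total m (crosses next X₀ ∘ map₁ (4 ↑ʳ_))))
      spineBit : ∀ (i : Fin 3) → bit (X₀ (inject₁ i ↑ˡ m) xor X₀ (suc i ↑ˡ m)) ≡
                                 bit (crosses next X₀ (inject₁ i ↑ˡ m , false))
      spineBit i = cong (λ h → bit (X₀ (inject₁ i ↑ˡ m) xor X₀ (proj₁ h))) (sym (spine i))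

    local-extension : Local x t c
    local-extension = fromSearch (newLocal X₁₆)
      where
      fromSearch : 6 ≤ c ⊎ Local (λ j → lookup (tabulate X₁₆) (j ↑ˡ 4)) (λ i → lookup (tabulate X₁₆) (12 ↑ʳ i)) c →
                   Local x t c
      fromSearch (inj₂ loc) = local-resp
        (λ { 0F → refl ; 1F → refl ; 2F → refl ; 3F → refl ; 4F → refl ; 5F → refl
           ; 6F → refl ; 7F → refl ; 8F → refl ; 9F → refl ; 10F → refl ; 11F → refl })
        (λ { 0F → refl ; 1F → refl ; 2F → refl ; 3F → refl }) loc
      -- If six new edges are cut, all four conditions follow from `spineCut t ≤ 3`: the hypotheses
      -- `c ≤ 5` and `c ≤ 1 + spineCut t` both fail.
      fromSearch (inj₁ 6≤c) = local
        (≤-trans (spineCut≤3 t) (≤-trans (m≤n+m 3 3) 6≤c))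
        (λ _ _ → inj₁ (≤-trans (m≤n+m 4 2) 6≤c))
        (λ _ _ c≤5 → contradiction (≤-trans 6≤c c≤5) 1+n≰n)
        (λ _ _ _ c≤ → contradiction (≤-trans 6≤c (≤-trans c≤ (+-monoʳ-≤ 1 (spineCut≤3 t))))
                                    (<⇒≱ (s≤s (m≤n+m 4 1))))

    open Local local-extension

    cut-old≤ : cut next X₀ ≤ cut next′ X
    cut-old≤ = +-cancelʳ-≤ (spineCut t) _ _
      (≤-trans (+-monoʳ-≤ (cut next X₀) spine≤) (≤-reflexive (sym cut-extension)))

    -- If the old vertices all lie on one side, no spine edge is cut, so nothing is subtracted from
    -- the new edges in `cut-extension`.
    c≤cut : ∀ {b} → (∀ v → X₀ v ≡ b) → c ≤ cut next′ X
    c≤cut {b} u = begin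
      c                          ≤⟨ m≤n+m c (cut next X₀) ⟩
      cut next X₀ + c            ≡⟨ cut-extension ⟨
      cut next′ X + spineCut t   ≡⟨ cong (cut next′ X +_) spine≡0 ⟩
      cut next′ X + 0            ≡⟨ +-identityʳ _ ⟩
      cut next′ X                ∎
      where
      open ≤-Reasoning
      spine≡0 : spineCut t ≡ 0
      spine≡0 rewrite u 0F | u 1F | u 2F | u 3F | xor-same b = refl

    everywhere : ∀ {P : Fin (12 + (4 + m)) → Set} → (∀ (j : Fin 12) → P (j ↑ˡ (4 + m))) → (∀ v → P (12 ↑ʳ v)) → ∀ v → P v
    everywhere p q v with place v
    ... | new j = p j
    ... | kept w = q w

    -- If the old part is uniform, only new edges can be cut and `uniform`, `uniform′` apply.
    -- Otherwise at least 4 old edges are cut; a cut of at most 5 in the extension then leaves at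
    -- most `1 + spineCut t` new edges cut, and `almost` puts every new vertex on the majority side
    -- of the old part.
    extension-tight′ : (4 ≤ cut next X₀ ⊎ Uniform X₀) × (cut next X₀ ≤ 5 → AlmostUniform X₀) →
                       (4 ≤ cut next′ X ⊎ Uniform X) × (cut next′ X ≤ 5 → AlmostUniform X)
    extension-tight′ (inj₂ (b , u) , _) =
      [ (λ 4≤c → inj₁ (≤-trans 4≤c (c≤cut u))) , (λ f → inj₂ (b , everywhere f u)) ]′
        (uniform b (λ i → u (i ↑ˡ m))) ,
      λ cut≤5 → let z , f = uniform′ b (λ i → u (i ↑ˡ m)) (≤-trans (c≤cut u) cut≤5) in
        b , z ↑ˡ (4 + m) , everywhere (λ j j≢z → f j (j≢z ∘ cong (_↑ˡ (4 + m)))) (λ v _ → u v)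
    extension-tight′ (inj₁ 4≤cut , small) = inj₁ (≤-trans 4≤cut cut-old≤) , λ cut≤5 →
      let b , z , f = small (≤-trans cut-old≤ cut≤5)
          c≤ = +-cancelˡ-≤ 4 c (1 + spineCut t) (begin
            4 + c                     ≤⟨ +-monoˡ-≤ c 4≤cut ⟩
            cut next X₀ + c           ≡⟨ cut-extension ⟨
            cut next′ X + spineCut t  ≤⟨ +-monoˡ-≤ (spineCut t) cut≤5 ⟩
            5 + spineCut t            ∎)
      in b , 12 ↑ʳ z ,
         everywhere (λ j _ → newUniform b z f c≤ j) (λ v v≢z → f v (v≢z ∘ cong (12 ↑ʳ_)))
      where
      open ≤-Reasoning
      newUniform : ∀ b z → (∀ v → v ≢ z → X₀ v ≡ b) → c ≤ 1 + spineCut t → ∀ j → x j ≡ b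
      newUniform b z f with splitAt 4 z in eq
      ... | inj₁ i = almost b i λ k k≢i →
        f (k ↑ˡ m) (λ e → k≢i (↑ˡ-injective m k i (trans e (sym (splitAt⁻¹-↑ˡ eq)))))
      -- The exceptional vertex lies off the spine, so all four spine vertices have value `b` and
      -- any index may be named as the exception.
      ... | inj₂ w = almost b 0F λ k _ → f (k ↑ˡ m) λ e → apart k (trans e (sym (splitAt⁻¹-↑ʳ eq)))
        where
        apart : ∀ (k : Fin 4) → k ↑ˡ m ≢ 4 ↑ʳ w
        apart 0F ()
        apart 1F ()
        apart 2F ()
        apart 3F ()

  extension-tight : Tight next → Tight next′
  extension-tight tight X = extension-tight′ X (tight (X ∘ (12 ↑ʳ_)))

-- Compatible colourings and a search through them

-- Equality of the unordered pairs {a , b} and {c , d}.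
Matched : {C : Set} → C → C → C → C → Set
Matched a b c d = (a ≡ c × b ≡ d) ⊎ (a ≡ d × b ≡ c)

record Compatible {N} {C : Set} (prev : Strand N → Strand N) (col : Strand N → C) : Set where
  field
    distinct : ∀ h → col (prev h) ≢ col h
    matched  : ∀ v → Matched (col (prev (v , false))) (col (v , false))
                             (col (prev (v , true)))  (col (v , true))

module _ {C : Set} where

  matched-trans : ∀ {a b c d e f : C} → Matched a b c d → Matched c d e f → Matched a b e f
  matched-trans (inj₁ (refl , refl)) m = m
  matched-trans (inj₂ (refl , refl)) (inj₁ (p , q)) = inj₂ (q , p)
  matched-trans (inj₂ (refl , refl)) (inj₂ (p , q)) = inj₁ (q , p)

  matched-distinct : ∀ {a b c d : C} → Matched a b c d → c ≢ d → a ≢ b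
  matched-distinct (inj₁ (refl , refl)) c≢d = c≢d
  matched-distinct (inj₂ (refl , refl)) c≢d = c≢d ∘ sym

Quad : Set
Quad = ℕ × ℕ × ℕ × ℕ

rename : ℕ → ℕ → ℕ → ℕ
rename a b x = if x ≡ᵇ a then b else x

-- Makes `a` equal to `b` and `c` equal to `d`. The first renaming may change `c` or `d`, so the
-- second acts on their current names.
identify : ℕ → ℕ → ℕ → ℕ → ℕ → ℕ
identify a b c d = rename (rename a b c) (rename a b d) ∘ rename a b

mapQuad : (ℕ → ℕ) → Quad → Quad
mapQuad f (a , b , c , d) = f a , f b , f c , f d

-- Search through the colourings of edges named by numbers: each vertex identifies
-- its four edges in pairs in one of two ways, and a branch is closed when two edges
-- known to be distinct are identified.  The goal is tested on the surviving
-- names of the edges in o.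
module _ {l : ℕ} (goal : Vec ℕ l → Bool) where

  refute : ∀ {k} → Vec Quad k → List (ℕ × ℕ) → Vec ℕ l → Bool

  attempt : ∀ {k} → (ℕ → ℕ) → Vec Quad k → List (ℕ × ℕ) → Vec ℕ l → Bool
  refute []                      ds o = goal o
  refute ((a , b , c , d) ∷ qs) ds o =
    attempt (identify a c b d) qs ds o ∧ attempt (identify a d b c) qs ds o
  attempt f qs ds o =
    any (λ (x , y) → f x ≡ᵇ f y) ds ∨
    refute (Vec.map (mapQuad f) qs) (map (Product.map f f) ds) (Vec.map f o)

  module _ {C : Set} (col : ℕ → C) where

    MatchedQuad : Quad → Set
    MatchedQuad (a , b , c , d) = Matched (col a) (col b) (col c) (col d)

    Distinct : ℕ × ℕ → Set
    Distinct (x , y) = col x ≢ col y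

    Outcome : Vec ℕ l → Set
    Outcome o = ∃[ o′ ] T (goal o′) × Vec.map col o′ ≡ Vec.map col o

    rename-col : ∀ a b → col a ≡ col b → ∀ x → col (rename a b x) ≡ col x
    rename-col a b eq x with x ≡ᵇ a in test
    ... | true  = trans (sym eq) (cong col (sym (≡ᵇ⇒≡ x a (Equivalence.from T-≡ test))))
    ... | false = refl

    identify-col : ∀ {a b c d} → col a ≡ col b → col c ≡ col d →
                   ∀ x → col (identify a b c d x) ≡ col x
    identify-col {a} {b} {c} {d} ab cd x =
      trans (rename-col (rename a b c) (rename a b d)
              (trans (rename-col a b ab c) (trans cd (sym (rename-col a b ab d)))) (rename a b x))
            (rename-col a b ab x)

    module _ (f : ℕ → ℕ) (f-col : ∀ x → col (f x) ≡ col x) where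

      mapQuad-matched : ∀ {q} → MatchedQuad q → MatchedQuad (mapQuad f q)
      mapQuad-matched {a , b , c , d} m rewrite f-col a | f-col b | f-col c | f-col d = m

      map-distinct : ∀ {p} → Distinct p → Distinct (Product.map f f p)
      map-distinct {x , y} x≢y rewrite f-col x | f-col y = x≢y

    -- A colouring selects one branch, by the way its colours match at each vertex. Along it every
    -- renaming preserves colours, so names of distinctly coloured edges never clash, and the branch
    -- must reach a leaf that passes `goal`.
    refute-sound : ∀ {k} (qs : Vec Quad k) ds o → VecAll.All MatchedQuad qs → All Distinct ds →
                   T (refute qs ds o) → Outcome o
    attempt-sound : ∀ {k} f (qs : Vec Quad k) ds o → (∀ x → col (f x) ≡ col x) →
                    VecAll.All MatchedQuad qs → All Distinct ds → T (attempt f qs ds o) → Outcome o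

    refute-sound [] ds o _ _ t = o , t , refl
    refute-sound ((a , b , c , d) ∷ qs) ds o (m ∷ ms) dist t
      with Equivalence.to (T-∧ {attempt (identify a c b d) qs ds o}) t | m
    ... | t₁ , t₂ | inj₁ (ac , bd) =
      attempt-sound (identify a c b d) qs ds o (identify-col ac bd) ms dist t₁
    ... | t₁ , t₂ | inj₂ (ad , bc) =
      attempt-sound (identify a d b c) qs ds o (identify-col ad bc) ms dist t₂

    attempt-sound f qs ds o f-col ms dist t
      with Equivalence.to (T-∨ {any (λ (x , y) → f x ≡ᵇ f y) ds}) t
    ... | inj₁ clash =
      contradiction (Any.any⁻ (λ (x , y) → f x ≡ᵇ f y) ds clash) (All.All¬⇒¬Any (All.map apart dist))
      where
      apart : ∀ {p} → Distinct p → ¬ T (f (proj₁ p) ≡ᵇ f (proj₂ p))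
      apart {x , y} x≢y e =
        x≢y (trans (sym (f-col x)) (trans (cong col (≡ᵇ⇒≡ (f x) (f y) e)) (f-col y)))
    ... | inj₂ rest
      with o′ , g , eq ← refute-sound (Vec.map (mapQuad f) qs) (map (Product.map f f) ds) (Vec.map f o)
             (VecAll.map⁺ (VecAll.map (λ {q} → mapQuad-matched f f-col {q}) ms))
             (All.map⁺ (All.map (λ {p} → map-distinct f f-col {p}) dist)) rest =
      o′ , g , trans eq (trans (sym (map-∘ col f o)) (map-cong f-col o))

-- Twice the vertex plus the bit. The value is independent of `N`, so names computed in a small
-- network denote the corresponding strands of a larger one.
code : ∀ {N} → Strand N → ℕ
code (v , s) = toℕ v + (toℕ v + bit s)

decode : ∀ {N} → ℕ → Strand (suc N)
decode {N}     zero          = zero , false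
decode {N}     (suc zero)    = zero , true
-- An arbitrary strand for codes out of range, making `col ∘ decode` defined on all names.
decode {zero}  (suc (suc k)) = zero , false
decode {suc N} (suc (suc k)) = map₁ suc (decode k)

turn : ∀ {N} → (Strand N → Strand N) → Strand N → ℕ × ℕ
turn prev h = code (prev h) , code h

star : ∀ {N} → (Strand N → Strand N) → Fin N → Quad
star prev v =
  let a , b = turn prev (v , false)
      c , d = turn prev (v , true)
  in a , b , c , d

-- With a goal that accepts no leaf, the search succeeds only by closing every branch.
petersen-uncolourable : {C : Set} (col : Strand 5 → C) → ¬ Compatible petersenPrev col
petersen-uncolourable col compatible = impossible (refute-sound {0} (λ _ → false) (col ∘ decode)
    (Vec.map (star petersenPrev) (0F ∷ 1F ∷ 2F ∷ 3F ∷ 4F ∷ []))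
    (map (turn petersenPrev)
      ((0F , false) ∷ (1F , false) ∷ (2F , false) ∷ (3F , false) ∷ (4F , false) ∷
       (0F , true) ∷ (1F , true) ∷ (2F , true) ∷ (3F , true) ∷ (4F , true) ∷ [])) []
    (matched 0F ∷ matched 1F ∷ matched 2F ∷ matched 3F ∷ matched 4F ∷ [])
    (distinct _ ∷ distinct _ ∷ distinct _ ∷ distinct _ ∷ distinct _ ∷
     distinct _ ∷ distinct _ ∷ distinct _ ∷ distinct _ ∷ distinct _ ∷ []) tt)
  where
  open Compatible compatible
  impossible : ¬ Outcome {0} (λ _ → false) (col ∘ decode) []
  impossible (_ , () , _)

-- Restricting a colouring of the extension to the old network

-- The replaced edge can be given the colour x.
Bridge : {C : Set} → C → C → C → C → C → C → Set
Bridge a i o i′ o′ b = ∃[ x ] Matched a x i o × Matched x b i′ o′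

module Colouring {m : ℕ} (B : Network m) {C : Set} (col : Strand (12 + (4 + m)) → C)
         (compatible : Compatible (Extension.prev′ B) col) where
  open Network B
  open Extension B
  open Compatible compatible

  -- The search uses the matchings at the twelve new vertices and the distinctness at their
  -- transitions and at those where the old vertices 1 and 2 are attached to the new part.
  bridge : Bridge (col (old 0F , false)) (col (6F , true)) (col (old 1F , false))
                  (col (8F , true)) (col (old 2F , false)) (col (3F , false))
  bridge = from-leaf (refute-sound goal (col ∘ decode)
      -- Any order of the vertices is sound; this one takes the outer paths of the three copies one
      -- after another.
      (Vec.map (star prev₁₆) (7F ∷ 9F ∷ 8F ∷ 4F ∷ 6F ∷ 5F ∷ 0F ∷ 1F ∷ 2F ∷ 11F ∷ 3F ∷ 10F ∷ []))
      (map (turn prev₁₆)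
        ((0F , false) ∷ (1F , false) ∷ (2F , false) ∷ (3F , false) ∷ (4F , false) ∷ (5F , false) ∷
         (6F , false) ∷ (7F , false) ∷ (8F , false) ∷ (9F , false) ∷ (10F , false) ∷ (11F , false) ∷
         (0F , true) ∷ (1F , true) ∷ (2F , true) ∷ (3F , true) ∷ (4F , true) ∷ (5F , true) ∷
         (6F , true) ∷ (7F , true) ∷ (8F , true) ∷ (9F , true) ∷ (10F , true) ∷ (11F , true) ∷
         (old 1F , false) ∷ (old 2F , false) ∷ []))
      (Vec.map (code {16}) ((old 0F , false) ∷ (6F , true) ∷ (old 1F , false) ∷
                     (8F , true) ∷ (old 2F , false) ∷ (3F , false) ∷ []))
      (matched 7F ∷ matched 9F ∷ matched 8F ∷ matched 4F ∷ matched 6F ∷ matched 5F ∷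
       matched 0F ∷ matched 1F ∷ matched 2F ∷ matched 11F ∷ matched 3F ∷ matched 10F ∷ [])
      (distinct _ ∷ distinct _ ∷ distinct _ ∷ distinct _ ∷ distinct _ ∷ distinct _ ∷
       distinct _ ∷ distinct _ ∷ distinct _ ∷ distinct _ ∷ distinct _ ∷ distinct _ ∷
       distinct _ ∷ distinct _ ∷ distinct _ ∷ distinct _ ∷ distinct _ ∷ distinct _ ∷
       distinct _ ∷ distinct _ ∷ distinct _ ∷ distinct _ ∷ distinct _ ∷ distinct _ ∷
       distinct _ ∷ distinct _ ∷ []) tt)
    where
    prev₁₆ : Strand 16 → Strand 16
    prev₁₆ = extPrev {0} id id

    -- A bridging colour must be one of the colours `i`, `o`, so these two candidates are tried on
    -- the names.
    Leaf : Vec ℕ 6 → Set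
    Leaf (a ∷ i ∷ o ∷ i′ ∷ o′ ∷ b ∷ []) =
      (Matched a o i o × Matched o b i′ o′) ⊎ (Matched a i i o × Matched i b i′ o′)

    matched? : ∀ a b c d → Dec (Matched {ℕ} a b c d)
    matched? a b c d = (a ℕ.≟ c ×-dec b ℕ.≟ d) ⊎-dec (a ℕ.≟ d ×-dec b ℕ.≟ c)

    leaf? : ∀ o → Dec (Leaf o)
    leaf? (a ∷ i ∷ o ∷ i′ ∷ o′ ∷ b ∷ []) =
      (matched? a o i o ×-dec matched? o b i′ o′) ⊎-dec (matched? a i i o ×-dec matched? i b i′ o′)

    goal : Vec ℕ 6 → Bool
    goal o = ⌊ leaf? o ⌋

    matched-map : ∀ (f : ℕ → C) {a b c d} → Matched a b c d → Matched (f a) (f b) (f c) (f d)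
    matched-map f (inj₁ (p , q)) = inj₁ (cong f p , cong f q)
    matched-map f (inj₂ (p , q)) = inj₂ (cong f p , cong f q)

    from-leaf : ∀ {a i o i′ o′ b} →
      (∃[ u ] T (goal u) × Vec.map (col ∘ decode) u ≡ a ∷ i ∷ o ∷ i′ ∷ o′ ∷ b ∷ []) →
      Bridge a i o i′ o′ b
    from-leaf (u@(_ ∷ _ ∷ _ ∷ _ ∷ _ ∷ _ ∷ []) , t , refl) with toWitness {a? = leaf? u} t
    ... | inj₁ (p , q) = _ , matched-map (col ∘ decode) p , matched-map (col ∘ decode) q
    ... | inj₂ (p , q) = _ , matched-map (col ∘ decode) p , matched-map (col ∘ decode) q

  module Restriction {x : C}
    (b₁ : Matched (col (old 0F , false)) x (col (6F , true)) (col (old 1F , false)))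
    (b₂ : Matched x (col (3F , false)) (col (8F , true)) (col (old 2F , false))) where

    -- Along the old spine the colours are that of the edge leaving `old 0F`, then `x`, then that of
    -- the edge entering `old 3F`. The first already has the right name under `lift`.
    restricted : Strand (4 + m) → C
    restricted (1F , false) = x
    restricted (2F , false) = col (3F , false)
    restricted h            = col (lift h)

    restricted-off : ∀ h → (∀ (i : Fin 3) → h ≢ (inject₁ i ↑ˡ m , false)) → restricted h ≡ col (lift h)
    restricted-off (0F , s)     off = refl
    restricted-off (1F , false) off = contradiction refl (off 1F)
    restricted-off (1F , true)  off = refl
    restricted-off (2F , false) off = contradiction refl (off 2F)
    restricted-off (2F , true)  off = refl
    restricted-off (3F , s)     off = refl
    restricted-off (inner w , s) off = refl

    restricted-prev-off : ∀ h → OffSpine h → restricted (prev h) ≡ col (prev′ (lift h))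
    restricted-prev-off h off =
      trans (restricted-off (prev h) λ i eq →
              off i (trans (sym (next-prev h)) (trans (cong next eq) (spine i))))
            (cong col (sym (prev-lift h off)))

    restricted-prev-3F : restricted (prev (3F , false)) ≡ col (3F , false)
    restricted-prev-3F = cong restricted (spine⁻¹ 2F)

    restricted-distinct : ∀ h → restricted (prev h) ≢ restricted h
    restricted-distinct (1F , false) rewrite spine⁻¹ 0F =
      matched-distinct (b₁) (distinct (old 1F , false))
    restricted-distinct (2F , false) rewrite spine⁻¹ 1F =
      matched-distinct (b₂) (distinct (old 2F , false))
    restricted-distinct (3F , false) rewrite restricted-prev-3F = distinct (old 3F , false)
    restricted-distinct (0F , s)
      rewrite restricted-prev-off (0F , s) (λ { 0F () ; 1F () ; 2F () }) = distinct (old 0F , s)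
    restricted-distinct (1F , true)
      rewrite restricted-prev-off (1F , true) (λ { 0F () ; 1F () ; 2F () }) = distinct (old 1F , true)
    restricted-distinct (2F , true)
      rewrite restricted-prev-off (2F , true) (λ { 0F () ; 1F () ; 2F () }) = distinct (old 2F , true)
    restricted-distinct (3F , true)
      rewrite restricted-prev-off (3F , true) (λ { 0F () ; 1F () ; 2F () }) = distinct (old 3F , true)
    restricted-distinct (inner w , s)
      rewrite restricted-prev-off (inner w , s) (λ { 0F () ; 1F () ; 2F () }) =
      distinct (old (inner w) , s)

    -- At the old vertices 1 and 2 the bridge says that the restored transition has the same pair of
    -- colours as the one it replaces; elsewhere the colours are unchanged.
    restricted-matched : ∀ v → Matched (restricted (prev (v , false))) (restricted (v , false))
                                       (restricted (prev (v , true)))  (restricted (v , true))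
    restricted-matched 0F
      rewrite restricted-prev-off (0F , false) (λ { 0F () ; 1F () ; 2F () })
            | restricted-prev-off (0F , true) (λ { 0F () ; 1F () ; 2F () }) = matched (old 0F)
    restricted-matched 1F
      rewrite spine⁻¹ 0F
            | restricted-prev-off (1F , true) (λ { 0F () ; 1F () ; 2F () }) =
      matched-trans (b₁) (matched (old 1F))
    restricted-matched 2F
      rewrite spine⁻¹ 1F
            | restricted-prev-off (2F , true) (λ { 0F () ; 1F () ; 2F () }) =
      matched-trans (b₂) (matched (old 2F))
    restricted-matched 3F
      rewrite restricted-prev-3F
            | restricted-prev-off (3F , true) (λ { 0F () ; 1F () ; 2F () }) = matched (old 3F)
    restricted-matched (inner w)
      rewrite restricted-prev-off (inner w , false) (λ { 0F () ; 1F () ; 2F () })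
            | restricted-prev-off (inner w , true) (λ { 0F () ; 1F () ; 2F () }) =
      matched (old (inner w))

    restricted-compatible : Compatible prev restricted
    restricted-compatible = record { distinct = restricted-distinct ; matched = restricted-matched }

-- Realising a network as a graph with a transition system

module _ {A : Set} where

  -- Compares the filtered list behind `degree` with explicit lists of half-edges, in both
  -- directions. One occurrence of `x` is removed from `ys` before the induction.
  unique⊆⇒length≤ : ∀ {xs ys : List A} → Unique xs → (∀ {x} → x ∈ˡ xs → x ∈ˡ ys) → length xs ≤ length ys
  unique⊆⇒length≤ {[]}     _          _  = z≤n
  unique⊆⇒length≤ {x ∷ xs} (x∉xs ∷ u) xs⊆ys with as , bs , refl ← ∈-∃++ (xs⊆ys (here refl)) = begin
    suc (length xs)               ≤⟨ s≤s (unique⊆⇒length≤ u xs⊆as++bs) ⟩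
    suc (length (as ++ bs))       ≡⟨ cong suc (length-++ as) ⟩
    suc (length as + length bs)   ≡⟨ +-suc (length as) (length bs) ⟨
    length as + suc (length bs)   ≡⟨ length-++ as ⟨
    length (as ++ [ x ] ++ bs)    ∎
    where
    open ≤-Reasoning
    xs⊆as++bs : ∀ {y} → y ∈ˡ xs → y ∈ˡ (as ++ bs)
    xs⊆as++bs y∈xs with ∈-++⁻ as (xs⊆ys (there y∈xs))
    ... | inj₁ y∈as         = ∈-++⁺ˡ y∈as
    ... | inj₂ (here refl)  = contradiction refl (All.lookup x∉xs y∈xs)
    ... | inj₂ (there y∈bs) = ∈-++⁺ʳ as y∈bs

-- Interleaves the two strands of each vertex in the order in which `total` adds them, so that sizes
-- of edge sets and `total` follow the same recursion.
encode : ∀ {N} → Strand N → Fin (N * 2)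
encode (zero  , false) = zero
encode (zero  , true)  = suc zero
encode (suc v , s)     = suc (suc (encode (v , s)))

strandOf : ∀ N → Fin (N * 2) → Strand N
strandOf (suc N) zero          = zero , false
strandOf (suc N) (suc zero)    = zero , true
strandOf (suc N) (suc (suc e)) = map₁ suc (strandOf N e)

strandOf-encode : ∀ {N} (h : Strand N) → strandOf N (encode h) ≡ h
strandOf-encode (zero  , false) = refl
strandOf-encode (zero  , true)  = refl
strandOf-encode (suc v , s)     = cong (map₁ suc) (strandOf-encode (v , s))

encode-strandOf : ∀ N (e : Fin (N * 2)) → encode (strandOf N e) ≡ e
encode-strandOf (suc N) zero          = refl
encode-strandOf (suc N) (suc zero)    = refl
encode-strandOf (suc N) (suc (suc e)) = cong (λ e → suc (suc e)) (encode-strandOf N e)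

∣tabulate∣≡total : ∀ N (f : Strand N → Bool) → ∣ tabulate (f ∘ strandOf N) ∣ ≡ total N f
∣tabulate∣≡total zero    f = refl
∣tabulate∣≡total (suc N) f with f (zero , false) | f (zero , true)
... | false | false = ∣tabulate∣≡total N (f ∘ map₁ suc)
... | false | true  = cong suc (∣tabulate∣≡total N (f ∘ map₁ suc))
... | true  | false = cong suc (∣tabulate∣≡total N (f ∘ map₁ suc))
... | true  | true  = cong (2 +_) (∣tabulate∣≡total N (f ∘ map₁ suc))

module Realisation {m : ℕ} (B : Network m) where
  open Network B

  strand : Fin ((4 + m) * 2) → Strand (4 + m)
  strand = strandOf (4 + m)

  strand-encode : ∀ h → strand (encode h) ≡ h
  strand-encode = strandOf-encode

  encode-strand : ∀ e → encode (strand e) ≡ e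
  encode-strand = encode-strandOf (4 + m)

  G : Graph
  G = record
    { order = 4 + m
    ; size  = (4 + m) * 2
    ; end   = λ { (e , false) → proj₁ (strand e) ; (e , true) → proj₁ (next (strand e)) }
    }

  open Graph G using (Vertex; HalfEdge; end; edge; opposite; halfEdges)

  -- The start of the edge `h` and the arrival of the edge `prev h`: both lie at the vertex of `h`
  -- and form a transition there.
  out into : Strand (4 + m) → HalfEdge
  out h = encode h , false
  into h = encode (prev h) , true

  system : TransitionSystem G
  system = record
    { partner = λ { (e , false) → into (strand e) ; (e , true) → out (next (strand e)) }
    ; partner-end = λ
        { (e , false) → trans (cong (proj₁ ∘ next) (strand-encode (prev (strand e))))
                              (cong proj₁ (next-prev (strand e)))
        ; (e , true)  → cong proj₁ (strand-encode (next (strand e))) }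
    ; partner-involutive = λ
        { (e , false) → cong (_, false) (trans
            (cong (encode ∘ next) (strand-encode (prev (strand e))))
            (trans (cong encode (next-prev (strand e))) (encode-strand e)))
        ; (e , true) → cong (_, true) (trans
            (cong (encode ∘ prev) (strand-encode (next (strand e))))
            (trans (cong encode (prev-next (strand e))) (encode-strand e))) }
    ; partner-distinct = λ { (e , false) () ; (e , true) () }
    }

  at : Vertex → List HalfEdge
  at v = out (v , false) ∷ out (v , true) ∷ into (v , false) ∷ into (v , true) ∷ []

  end-out : ∀ h → end (out h) ≡ proj₁ h
  end-out h = cong proj₁ (strand-encode h)

  end-into : ∀ h → end (into h) ≡ proj₁ h
  end-into h = trans (cong (proj₁ ∘ next) (strand-encode (prev h))) (cong proj₁ (next-prev h))

  out-∈ : ∀ h → out h ∈ˡ at (proj₁ h)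
  out-∈ (v , false) = here refl
  out-∈ (v , true)  = there (here refl)

  into-∈ : ∀ h → into h ∈ˡ at (proj₁ h)
  into-∈ (v , false) = there (there (here refl))
  into-∈ (v , true)  = there (there (there (here refl)))

  ∈-at : ∀ h → h ∈ˡ at (end h)
  ∈-at (e , false) =
    subst (_∈ˡ at (proj₁ (strand e))) (cong (_, false) (encode-strand e)) (out-∈ (strand e))
  ∈-at (e , true) =
    subst (_∈ˡ at (proj₁ (next (strand e))))
      (cong (_, true) (trans (cong encode (prev-next (strand e))) (encode-strand e)))
      (into-∈ (next (strand e)))

  encode-injective : ∀ {h k : Strand (4 + m)} → encode h ≡ encode k → h ≡ k
  encode-injective {h} {k} eq =
    trans (sym (strand-encode h)) (trans (cong strand eq) (strand-encode k))

  prev-injective : ∀ {h k} → prev h ≡ prev k → h ≡ k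
  prev-injective {h} {k} eq = trans (sym (next-prev h)) (trans (cong next eq) (next-prev k))

  at-unique : ∀ v → Unique (at v)
  at-unique v =
    (apart ∷ (λ ()) ∷ (λ ()) ∷ []) ∷ ((λ ()) ∷ (λ ()) ∷ []) ∷
    ((λ eq → case-false (prev-injective (encode-injective (cong proj₁ eq)))) ∷ []) ∷ [] ∷ []
    where
    case-false : (v , false) ≢ (v , true)
    case-false ()
    apart : out (v , false) ≢ out (v , true)
    apart eq = case-false (encode-injective (cong proj₁ eq))

  at-end : ∀ v {h} → h ∈ˡ at v → end h ≡ v
  at-end v (here refl)                         = end-out (v , false)
  at-end v (there (here refl))                 = end-out (v , true)
  at-end v (there (there (here refl)))         = end-into (v , false)
  at-end v (there (there (there (here refl)))) = end-into (v , true)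

  halfEdges-unique : Unique halfEdges
  halfEdges-unique =
    Unique.cartesianProduct⁺ {ys = false ∷ true ∷ []} (Unique.allFin⁺ _) (((λ ()) ∷ []) ∷ [] ∷ [])

  ∈-halfEdges : ∀ h → h ∈ˡ halfEdges
  ∈-halfEdges (e , b) = ∈-cartesianProduct⁺ {ys = false ∷ true ∷ []} (∈-allFin e) (∈-bools b)
    where
    ∈-bools : ∀ b → b ∈ˡ false ∷ true ∷ []
    ∈-bools false = here refl
    ∈-bools true  = there (here refl)

  module _ (H : Subgraph G) (v : Vertex) where
    open Subgraph H

    incident? : ∀ h → Dec (edge h ∈ edges × end h ≡ v)
    incident? h = (edge h ∈? edges) ×-dec (end h ≟ v)

    degree≤ : ∀ hs → (∀ {h} → h ∈ˡ at v → edge h ∈ edges → h ∈ˡ hs) → degree H v ≤ length hs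
    degree≤ hs sub = unique⊆⇒length≤ (Unique.filter⁺ incident? halfEdges-unique) λ {h} h∈ →
      let _ , e∈ , end≡ = ∈-filter⁻ incident? {xs = halfEdges} h∈ in sub (subst (λ w → h ∈ˡ at w) end≡ (∈-at h)) e∈

    ≤degree : ∀ {hs} → Unique hs → (∀ {h} → h ∈ˡ hs → h ∈ˡ at v × edge h ∈ edges) →
              length hs ≤ degree H v
    ≤degree u sub = unique⊆⇒length≤ u λ {h} h∈ → let h∈at , e∈ = sub h∈ in
      ∈-filter⁺ incident? (∈-halfEdges h) (e∈ , at-end v h∈at)

  regular : Regular (whole G) 4
  regular v _ = ≤-antisym (degree≤ (whole G) v (at v) λ h∈ _ → h∈)
                          (≤degree (whole G) v (at-unique v) λ h∈ → h∈ , ∈⊤)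

  module _ (D : CompatibleCycleDecomposition G system) where
    open CompatibleCycleDecomposition D

    colour : Strand (4 + m) → Fin count
    colour h = proj₁ (decomposes (encode h))

    colour-∈ : ∀ h → encode h ∈ Subgraph.edges (circuit (colour h))
    colour-∈ h = proj₁ (proj₂ (decomposes (encode h)))

    colour-distinct : ∀ h → colour (prev h) ≢ colour h
    colour-distinct h eq = compatible (colour h) (out h) (colour-∈ h ,
      subst (λ k → encode (prev k) ∈ Subgraph.edges (circuit (colour h))) (sym (strand-encode h))
        (subst (λ i → encode (prev h) ∈ Subgraph.edges (circuit i)) eq (colour-∈ (prev h))))

    hue : HalfEdge → Fin count
    hue k = proj₁ (decomposes (edge k))

    hue-∈ : ∀ k → edge k ∈ Subgraph.edges (circuit (hue k))
    hue-∈ k = proj₁ (proj₂ (decomposes (edge k)))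

    -- The circuit through `k` has degree 2 at `v`. It avoids `p`, so if it also avoided `q` and
    -- `r`, its degree at `v` would be at most 1.
    meets : ∀ {v} k {p q r} → end k ≡ v → (∀ {x} → x ∈ˡ at v → x ∈ˡ k ∷ p ∷ q ∷ r ∷ []) →
            hue p ≢ hue k → hue k ≡ hue q ⊎ hue k ≡ hue r
    meets {v} k {p} {q} {r} end≡ cover p≢k with hue q ≟ hue k | hue r ≟ hue k
    ... | yes q≡k | _       = inj₁ (sym q≡k)
    ... | no _    | yes r≡k = inj₂ (sym r≡k)
    ... | no q≢k  | no r≢k  = contradiction
      (subst (_≤ 1) (proj₂ (isCircuit (hue k)) v v∈) (degree≤ (circuit (hue k)) v (k ∷ []) λ x∈ e∈ → only (cover x∈) e∈))
      1+n≰n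
      where
      v∈ : v ∈ Subgraph.vertices (circuit (hue k))
      v∈ = subst (_∈ Subgraph.vertices (circuit (hue k))) end≡ (Subgraph.closed (circuit (hue k)) k (hue-∈ k))

      same : ∀ x → edge x ∈ Subgraph.edges (circuit (hue k)) → hue x ≡ hue k
      same x = proj₂ (proj₂ (decomposes (edge x)))

      only : ∀ {x} → x ∈ˡ k ∷ p ∷ q ∷ r ∷ [] → edge x ∈ Subgraph.edges (circuit (hue k)) → x ∈ˡ k ∷ []
      only (here eq)                         e∈ = here eq
      only (there (here refl))                 e∈ = contradiction (same p e∈) p≢k
      only (there (there (here refl)))         e∈ = contradiction (same q e∈) q≢k
      only (there (there (there (here refl)))) e∈ = contradiction (same r e∈) r≢k

    -- Each of the two colours at the false transition recurs at the true one; being different, they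
    -- recur on different edges.
    colour-matched : ∀ v → Matched (colour (prev (v , false))) (colour (v , false))
                                   (colour (prev (v , true)))  (colour (v , true))
    colour-matched v
      with meets (into (v , false)) (end-into (v , false)) cover₁ (colour-distinct (v , false) ∘ sym)
         | meets (out (v , false)) (end-out (v , false)) cover₂ (colour-distinct (v , false))
      where
      cover₁ : ∀ {x} → x ∈ˡ at v →
               x ∈ˡ into (v , false) ∷ out (v , false) ∷ into (v , true) ∷ out (v , true) ∷ []
      cover₁ (here eq)                         = there (here eq)
      cover₁ (there (here eq))                 = there (there (there (here eq)))
      cover₁ (there (there (here eq)))         = here eq
      cover₁ (there (there (there (here eq)))) = there (there (here eq))

      cover₂ : ∀ {x} → x ∈ˡ at v →
               x ∈ˡ out (v , false) ∷ into (v , false) ∷ into (v , true) ∷ out (v , true) ∷ []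
      cover₂ (here eq)                         = here eq
      cover₂ (there (here eq))                 = there (there (there (here eq)))
      cover₂ (there (there (here eq)))         = there (here eq)
      cover₂ (there (there (there (here eq)))) = there (there (here eq))
    ... | inj₁ a≡c | inj₁ b≡c = contradiction (trans a≡c (sym b≡c)) (colour-distinct (v , false))
    ... | inj₁ a≡c | inj₂ b≡d = inj₁ (a≡c , b≡d)
    ... | inj₂ a≡d | inj₁ b≡c = inj₂ (a≡d , b≡c)
    ... | inj₂ a≡d | inj₂ b≡d = contradiction (trans a≡d (sym b≡d)) (colour-distinct (v , false))

    colour-compatible : Compatible prev colour
    colour-compatible = record { distinct = colour-distinct ; matched = colour-matched }

  module _ (H : Subgraph G) where
    open Subgraph H

    adjacent : ∀ h → encode h ∈ edges → Adjacent H (proj₁ h) (proj₁ (next h))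
    adjacent h e∈ = out h , e∈ , end-out h , cong (proj₁ ∘ next) (strand-encode h)

    adjacent-sym : ∀ {u v} → Adjacent H u v → Adjacent H v u
    adjacent-sym ((e , false) , e∈ , p , q) = (e , true) , e∈ , q , p
    adjacent-sym ((e , true)  , e∈ , p , q) = (e , false) , e∈ , q , p

    reachable-sym : ∀ {u v} → Reachable H u v → Reachable H v u
    reachable-sym = reverse adjacent-sym

  loop-free : ∀ h → end h ≢ end (opposite h)
  loop-free (e , false) eq = loopless (strand e) (sym eq)
  loop-free (e , true)  eq = loopless (strand e) eq

  module _ (tight : Tight next) where

    -- The component of `u` after deleting `F` is a vertex set whose cut lies inside `F`. By
    -- tightness it or its complement has at most one vertex, which cannot carry an edge because
    -- there are no loops.
    essential : ¬ (∃[ F ] IsEdgeCut G F × ∣ F ∣ < 6 × TwoComponentsWithEdges (G ∖ F))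
    essential (F , _ , s≤s ∣F∣≤5 , u , v , _ , _ , u↛v , edge-u , edge-v) =
      -- The goal is a negation and there are finitely many vertices, so reachability from `u` may
      -- be assumed decided at all of them.
      sequence (RawMonad.rawApplicative ¬¬-Monad) (λ w → ¬¬-excluded-middle) λ reach? →
        separate reach? (proj₂ (tight (does ∘ reach?)) (cut≤5 reach?))
      where
      H : Subgraph G
      H = G ∖ F

      module _ (reach? : ∀ w → Dec (Reachable H u w)) where

        Y : Vertex → Bool
        Y = does ∘ reach?

        Y-agree : ∀ {a b} → Adjacent H a b → Y a xor Y b ≡ false
        Y-agree {a} {b} ab with reach? a | reach? b
        ... | yes _ | yes _ = refl
        ... | no _  | no _  = refl
        ... | yes p | no ¬q = contradiction (p ◅◅ ab ◅ ε) ¬q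
        ... | no ¬p | yes q = contradiction (q ◅◅ adjacent-sym H ab ◅ ε) ¬p

        crossing⊆F : tabulate (crosses next Y ∘ strand) ⊆ F
        crossing⊆F {e} e∈ with e ∈? F
        ... | yes e∈F = e∈F
        ... | no  e∉F with () ← trans (sym (Y-agree ((e , false) , x∉p⇒x∈∁p e∉F , refl , refl)))
                (trans (sym (lookup∘tabulate (crosses next Y ∘ strand) e)) ([]=⇒lookup e∈))

        cut≤5 : cut next Y ≤ 5
        cut≤5 = begin
          cut next Y                               ≡⟨ ∣tabulate∣≡total (4 + m) (crosses next Y) ⟨
          ∣ tabulate (crosses next Y ∘ strand) ∣   ≤⟨ p⊆q⇒∣p∣≤∣q∣ crossing⊆F ⟩
          ∣ F ∣                                    ≤⟨ ∣F∣≤5 ⟩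
          5                                        ∎
          where open ≤-Reasoning

        isolated : ∀ {z a} → (∀ w → Reachable H a w → w ≡ z) → ¬ ComponentHasEdge H a
        isolated only (h , e∈ , a→h) = loop-free h (trans (only _ a→h)
          (sym (only _ (a→h ◅◅ (h , e∈ , refl , refl) ◅ ε))))

        separate : ¬ AlmostUniform Y
        -- The component of `u` lies within `z`.
        separate (false , z , f) = isolated (λ w u→w → decide w u→w (w ≟ z)) edge-u
          where
          decide : ∀ w → Reachable H u w → Dec (w ≡ z) → w ≡ z
          decide w u→w (yes w≡z) = w≡z
          decide w u→w (no w≢z) with () ← trans (sym (dec-true (reach? w) u→w)) (f w w≢z)
        -- All vertices except possibly `z` are reachable from `u`, so the component of `v` lies
        -- within `z`.
        separate (true , z , f) = isolated (λ w v→w → decide w v→w (w ≟ z)) edge-v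
          where
          decide : ∀ w → Reachable H v w → Dec (w ≡ z) → w ≡ z
          decide w v→w (yes w≡z) = w≡z
          decide w v→w (no w≢z) with reach? w | f w w≢z
          ... | yes u→w | _ = contradiction (u→w ◅◅ reachable-sym H v→w) u↛v
          ... | no _    | ()

-- Connectedness

Step : ∀ {N} → (Strand N → Strand N) → Fin N → Fin N → Set
Step next u v = ∃[ h ] proj₁ h ≡ u × proj₁ (next h) ≡ v

Spanning : ∀ {m} → (Strand (4 + m) → Strand (4 + m)) → Set
Spanning next = ∀ v → EqClosure (Step next) 0F v

module _ {N : ℕ} (next : Strand N → Strand N) where

  hop : ∀ h → EqClosure (Step next) (proj₁ h) (proj₁ (next h))
  hop h = fwd (h , refl , refl) ◅ ε

  back : ∀ h → EqClosure (Step next) (proj₁ (next h)) (proj₁ h)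
  back h = bwd (h , refl , refl) ◅ ε

petersen-spanning : Spanning petersenNext
petersen-spanning 0F = ε
petersen-spanning 1F = hop petersenNext (0F , false)
petersen-spanning 2F = hop petersenNext (0F , true)
petersen-spanning 3F = back petersenNext (3F , true)
petersen-spanning 4F = back petersenNext (4F , false)

module _ {m : ℕ} (B : Network m) where
  open Network B
  open Extension B

  private
    _~_ : Fin (12 + (4 + m)) → Fin (12 + (4 + m)) → Set
    _~_ = EqClosure (Step next′)

  new-spanned : ∀ (j : Fin 12) → 0F ~ (j ↑ˡ (4 + m))
  new-spanned = λ
    { 0F → ε
    ; 1F → hop next′ (0F , false)
    ; 2F → to2F
    ; 3F → to3F
    ; 4F → to4F
    ; 5F → to4F ◅◅ hop next′ (4F , false)
    ; 6F → to4F ◅◅ hop next′ (4F , true)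
    ; 7F → to7F
    ; 8F → to7F ◅◅ back next′ (8F , false)
    ; 9F → to7F ◅◅ hop next′ (7F , true)
    ; 10F → back next′ (10F , false)
    ; 11F → to2F ◅◅ hop next′ (2F , true)
    }
    where
    to2F : 0F ~ 2F
    to2F = hop next′ (0F , true)
    to3F : 0F ~ 3F
    to3F = to2F ◅◅ hop next′ (2F , false)
    to4F : 0F ~ 4F
    to4F = to3F ◅◅ hop next′ (3F , true)
    to7F : 0F ~ 7F
    to7F = to3F ◅◅ back next′ (7F , false)

  0F~old0F : 0F ~ old 0F
  0F~old0F = back next′ (old 0F , false)

  0F~old1F : 0F ~ old 1F
  0F~old1F = new-spanned 6F ◅◅ hop next′ (6F , true)

  0F~old2F : 0F ~ old 2F
  0F~old2F = new-spanned 8F ◅◅ hop next′ (8F , true)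

  0F~old3F : 0F ~ old 3F
  0F~old3F = new-spanned 3F ◅◅ hop next′ (3F , false)

  between : ∀ {u v} → 0F ~ u → 0F ~ v → u ~ v
  between p q = symmetric (Step next′) p ◅◅ q

  -- A spine edge is replaced by a detour through the new vertices, which reach all four old spine
  -- vertices.
  lift-hop : ∀ h → old (proj₁ h) ~ old (proj₁ (next h))
  lift-hop (0F , false) rewrite spine 0F = between 0F~old0F 0F~old1F
  lift-hop (0F , true)  = hop next′ (old 0F , true)
  lift-hop (1F , false) rewrite spine 1F = between 0F~old1F 0F~old2F
  lift-hop (1F , true)  = hop next′ (old 1F , true)
  lift-hop (2F , false) rewrite spine 2F = between 0F~old2F 0F~old3F
  lift-hop (2F , true)  = hop next′ (old 2F , true)
  lift-hop (3F , s)      = hop next′ (old 3F , s)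
  lift-hop (inner w , s) = hop next′ (old (inner w) , s)

  lift-~ : ∀ {u v} → EqClosure (Step next) u v → old u ~ old v
  lift-~ = kleisliStar (λ v → old v) λ
    { (fwd (h , refl , refl)) → lift-hop h
    ; (bwd (h , refl , refl)) → symmetric (Step next′) (lift-hop h) }

  extension-spanning : Spanning next → Spanning next′
  extension-spanning spans v with place B v
  ... | new j  = new-spanned j
  ... | kept w = 0F~old0F ◅◅ lift-~ (spans w)

-- Iteration and the counterexamples

extraVertices : ℕ → ℕ
extraVertices zero    = 1
extraVertices (suc n) = 12 + extraVertices n

network : ∀ n → Network (extraVertices n)
network zero    = petersen
network (suc n) = Extension.extension (network n)

network-tight : ∀ n → Tight (Network.next (network n))
network-tight zero    = petersen-tight
network-tight (suc n) = extension-tight (network n) (network-tight n)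

network-spanning : ∀ n → Spanning (Network.next (network n))
network-spanning zero    = petersen-spanning
network-spanning (suc n) = extension-spanning (network n) (network-spanning n)

network-uncolourable : ∀ n {C : Set} (col : Strand (4 + extraVertices n) → C) →
                       ¬ Compatible (Network.prev (network n)) col
network-uncolourable zero    col compatible = petersen-uncolourable col compatible
network-uncolourable (suc n) col compatible =
  let x , b₁ , b₂ = Colouring.bridge (network n) col compatible in
  network-uncolourable n _
    (Colouring.Restriction.restricted-compatible (network n) col compatible b₁ b₂)

order≡ : ∀ n → 4 + extraVertices n ≡ 5 + 12 * n
order≡ zero    = refl
order≡ (suc n) = trans (cong (12 +_) (order≡ n)) (cong (5 +_) (sym (*-suc 12 n)))

module _ {m : ℕ} (B : Network m) (spans : Spanning (Network.next B)) where
  open Network B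
  open Realisation B

  connected : Connected (whole G)
  connected = (0F , ∈⊤) , λ u v _ _ → reachable-sym (whole G) (reach u) ◅◅ reach v
    where
    reach : ∀ v → Reachable (whole G) 0F v
    reach v = gmap (λ v → v) (λ
      { (fwd (h , refl , refl)) → adjacent (whole G) h ∈⊤
      ; (bwd (h , refl , refl)) → adjacent-sym (whole G) (adjacent (whole G) h ∈⊤) }) (spans v)

corollary2p27 : (n : ℕ) → 1 ≤ n →
    Σ Graph λ G → Σ (TransitionSystem G) λ T →
    Graph.order G ≡ 5 + 12 * n ×
    Regular (whole G) 4 ×
    EssentiallyEdgeConnected G 6 ×
    ¬ ((¬ CompatibleCycleDecomposition G T) ⇔ ((G , T) ≅ badLoop ⊎ (G , T) ≅ badK₅))
corollary2p27 (suc n) _ = G , system , order≡ (suc n) , regular ,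
  (connected B (network-spanning (suc n)) , essential (network-tight (suc n))) ,
  -- Lacking a decomposition, the pair would have to be the bad loop or the bad `K₅`, but it has at
  -- least 17 vertices against 1 and 5.
  λ iff → [ (λ iso → contradiction (↔⇒≡ (_≅_.vertex↔ iso)) λ ())
          , (λ iso → contradiction (↔⇒≡ (_≅_.vertex↔ iso)) λ ()) ]′
    (Equivalence.to iff λ D → network-uncolourable (suc n) (colour D) (colour-compatible D))
  where
  B : Network (extraVertices (suc n))
  B = network (suc n)
  open Realisation B
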